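{- Let $(a_i)_{i\ge1}$ be a reversed prime Fibonacci sequence which is eventually monotonic. Then the set of its terms has asymptotic density zero in the primes, i.e. $\#\{i : a_i\le x\}/\pi(x)\to 0$ as $x\to\infty$, where $\pi(x)$ is the number of primes $\le x$.
   Context: Let $p,q$ be distinct odd primes. The reversed prime Fibonacci sequence generated by $p,q$ is the sequence $(a_i)_{i\ge1}$ with $a_1=p$, $a_2=q$, and for all $i\ge 1$, $a_{i+2}$ is the smallest odd prime with the property that $a_i$ is the smallest odd prime divisor of $a_{i+1}+a_{i+2}$. -}

module Defs where

open import Data.Nat using (ℕ; zero; suc; _+_; _*_; _≤_; _≤?_)
open import Data.Nat.Divisibility using (_∣_)
open import Data.Nat.Primality using (Prime; prime?)
open import Data.List using (List; []; _∷_; length; filter)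
open import Data.Product using (_×_; ∃-syntax)
open import Data.Sum using (_⊎_)
open import Relation.Nullary using (¬_)
open import Relation.Binary.PropositionalEquality using (_≡_; _≢_)

OddPrime : ℕ → Set
OddPrime r = Prime r × ¬ (2 ∣ r)

SmallestOddPrimeDivisor : ℕ → ℕ → Set
SmallestOddPrimeDivisor d m =
  OddPrime d × d ∣ m × (∀ r → OddPrime r → r ∣ m → d ≤ r)

IsNextTerm : ℕ → ℕ → ℕ → Set
IsNextTerm x y r =
  OddPrime r × SmallestOddPrimeDivisor x (y + r)
  × (∀ s → OddPrime s → SmallestOddPrimeDivisor x (y + s) → r ≤ s)

-- a is the reversed prime Fibonacci sequence generated by p, q
-- (indexed from 1; the value a 0 is irrelevant)
IsRPFSeq : ℕ → ℕ → (ℕ → ℕ) → Set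
IsRPFSeq p q a =
  a 1 ≡ p × a 2 ≡ q × (∀ i → 1 ≤ i → IsNextTerm (a i) (a (suc i)) (a (suc (suc i))))

IsRPF : (ℕ → ℕ) → Set
IsRPF a = ∃[ p ] ∃[ q ] (OddPrime p × OddPrime q × p ≢ q × IsRPFSeq p q a)

EventuallyMonotonic : (ℕ → ℕ) → Set
EventuallyMonotonic a = ∃[ N ]
  ((∀ i → N ≤ i → a i ≤ a (suc i)) ⊎ (∀ i → N ≤ i → a (suc i) ≤ a i))

range1 : ℕ → List ℕ
range1 zero = []
range1 (suc n) = suc n ∷ range1 n

countUpTo : (ℕ → ℕ) → ℕ → ℕ → ℕ
countUpTo a n x = length (filter (λ i → a i ≤? x) (range1 n))

primeCount : ℕ → ℕ
primeCount x = length (filter prime? (range1 x))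

{-# OPTIONS --safe #-}

-- Consecutive terms of the sequence are distinct, so an eventually monotonic
-- one is eventually strictly increasing.  Then x ∣ y + z with x < y < z forces
-- y + z ≥ 3x, hence 2z ≥ 3x, and four steps at least double a term: only
-- O(log x) terms are ≤ x.  On the other side, Nair's argument shows that every
-- positive common multiple M of 1, …, 2n+1 is at least 4ⁿ, while some such M is
-- a product of π(x) prime powers ≤ x for any x ≥ 2n+1; thus π(x) ≥ c x / log x.
module Submission where

open import Defs
open import Data.Nat
open import Data.Nat.Properties
open import Data.Nat.Divisibility
open import Data.Nat.Primality
open import Data.Nat.Primality.Factorisation using (factorise; module PrimeFactorisation)
open import Data.Nat.Induction using (<-rec)
open import Data.Nat.Tactic.RingSolver using (solve-∀)
open import Data.List using ([]; _∷_; length)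
open import Data.List.Properties using (filter-reject; length-filter)
open import Data.List.Relation.Unary.All using ([]; _∷_)
open import Data.Product using (_×_; ∃-syntax; _,_; proj₁; proj₂)
open import Data.Sum using (inj₁; inj₂)
open import Function using (_∘_)
open import Relation.Nullary using (¬_; yes; no; contradiction)
open import Relation.Binary.PropositionalEquality

-- Powers and integer logarithms

-- Here `t` is the integer part of the logarithm of `n` to base `b`. It serves for the largest power
-- of a prime up to `N` and for the binary length of `x`.
^-bracket : ∀ b → 1 < b → ∀ n → 1 ≤ n → ∃[ t ] (b ^ t ≤ n × n < b ^ suc t)
^-bracket b 1<b 1 _ = 0 , ≤-refl , subst (1 <_) (sym (*-identityʳ b)) 1<b
^-bracket b 1<b (suc n@(suc _)) _ with ^-bracket b 1<b n (s≤s z≤n)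
... | t , lo , hi with suc n <? b ^ suc t
...   | yes lt = t , m≤n⇒m≤1+n lo , lt
...   | no ≮ = suc t , ≮⇒≥ ≮ , ≤-<-trans hi (^-monoʳ-< b 1<b (n<1+n (suc t)))

^-cancel-< : ∀ b .{{_ : NonZero b}} {m n} → b ^ m < b ^ n → m < n
^-cancel-< b lt = ≰⇒> (λ n≤m → <⇒≱ lt (^-monoʳ-≤ b n≤m))

^-cancel-≤ : ∀ b → 1 < b → ∀ {m n} → b ^ m ≤ b ^ n → m ≤ n
^-cancel-≤ b 1<b le = ≮⇒≥ (λ n<m → <⇒≱ (^-monoʳ-< b 1<b n<m) le)

^-monoʳ-∣ : ∀ b {m n} → m ≤ n → b ^ m ∣ b ^ n
^-monoʳ-∣ b {m} {n} m≤n = divides (b ^ (n ∸ m))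
  (trans (cong (b ^_) (sym (m∸n+n≡m m≤n))) (^-distribˡ-+-* b (n ∸ m) m))

-- The base case is 1000 ≤ 1024. Doubling the right side suffices for the step because (s + 1)³ ≤
-- 2s³ for s ≥ 10; the added polynomial is the exact difference.
cube≤2^ : ∀ d → (10 + d) * ((10 + d) * (10 + d)) ≤ 2 ^ (10 + d)
cube≤2^ zero = m≤m+n 1000 24
cube≤2^ (suc d) = begin
  (11 + d) * ((11 + d) * (11 + d))      ≤⟨ m≤m+n _ (669 + 237 * d + 27 * (d * d) + d * (d * d)) ⟩
  (11 + d) * ((11 + d) * (11 + d)) + (669 + 237 * d + 27 * (d * d) + d * (d * d))
                                        ≡⟨ expand d ⟩
  2 * ((10 + d) * ((10 + d) * (10 + d))) ≤⟨ *-monoʳ-≤ 2 (cube≤2^ d) ⟩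
  2 * 2 ^ (10 + d)                      ∎
  where
  open ≤-Reasoning
  expand : ∀ d → (11 + d) * ((11 + d) * (11 + d)) + (669 + 237 * d + 27 * (d * d) + d * (d * d))
         ≡ 2 * ((10 + d) * ((10 + d) * (10 + d)))
  expand = solve-∀

-- A lower bound for π

-- M · ∫₀¹ xⁱ (1 − x)ʲ dx is an integer.
beta-multiple : ∀ {M N} → (∀ j → 1 ≤ j → j ≤ N → j ∣ M) → ∀ j i → suc (i + j) ≤ N →
  ∃[ u ] (u * suc (i + j) ! ≡ M * (i ! * j !))
-- For j = 0 the integral is 1 / (i + 1), and `suc i` divides `M`.
beta-multiple {M} cm zero i le with cm (suc i) (s≤s z≤n) (subst (λ h → suc h ≤ _) (+-identityʳ i) le)
... | divides u refl = u , (begin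
  u * suc (i + 0) !        ≡⟨ cong (λ h → u * suc h !) (+-identityʳ i) ⟩
  u * (suc i * i !)        ≡⟨ regroup u (suc i) (i !) ⟩
  u * suc i * (i ! * 1)    ∎)
  where
  open ≡-Reasoning
  regroup : ∀ u s f → u * (s * f) ≡ u * s * (f * 1)
  regroup = solve-∀
beta-multiple {M} {N} cm (suc j) i le
  with beta-multiple cm j i (≤-trans (s≤s (+-monoʳ-≤ i (n≤1+n j))) le)
     | beta-multiple cm j (suc i) (subst (λ h → suc h ≤ N) (+-suc i j) le)
-- Integrate xⁱ(1 - x)ʲ⁺¹ = xⁱ(1 - x)ʲ - xⁱ⁺¹(1 - x)ʲ. Truncation in `u ∸ v` is harmless, as the
-- right side becomes `A + B ∸ B`.
... | u , equ | v , eqv = u ∸ v , (begin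
  (u ∸ v) * suc (i + suc j) !     ≡⟨ cong (λ h → (u ∸ v) * suc h !) (+-suc i j) ⟩
  (u ∸ v) * F                     ≡⟨ *-distribʳ-∸ F u v ⟩
  u * F ∸ v * F                   ≡⟨ cong₂ _∸_ lhs eqv ⟩
  M * (i ! * j !) * (2 + (i + j)) ∸ M * (suc i ! * j !)
                                  ≡⟨ cong (_∸ M * (suc i ! * j !)) (split M i j (i !) (j !)) ⟩
  M * (i ! * suc j !) + M * (suc i ! * j !) ∸ M * (suc i ! * j !)
                                  ≡⟨ m+n∸n≡m (M * (i ! * suc j !)) (M * (suc i ! * j !)) ⟩
  M * (i ! * suc j !)             ∎)
  where
  open ≡-Reasoning
  F = suc (suc i + j) !
  regroup : ∀ u s f → u * (s * f) ≡ u * f * s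
  regroup = solve-∀
  split : ∀ M i j f g → M * (f * g) * (2 + (i + j)) ≡ M * (f * (suc j * g)) + M * (suc i * f * g)
  split = solve-∀
  lhs : u * F ≡ M * (i ! * j !) * (2 + (i + j))
  lhs = trans (regroup u (2 + (i + j)) (suc (i + j) !)) (cong (_* (2 + (i + j))) equ)

-- Equivalent to ∫₀¹ xⁿ(1 - x)ⁿ dx ≤ 4⁻ⁿ. Passing to n + 1 multiplies the left side by (2n + 2)² and
-- the right side by (2n + 3)(2n + 2).
4^n*n!²≤[1+2n]! : ∀ n → 4 ^ n * (n ! * n !) ≤ suc (n + n) !
4^n*n!²≤[1+2n]! zero = ≤-refl
4^n*n!²≤[1+2n]! (suc n) = begin
  4 ^ suc n * (suc n ! * suc n !)              ≡⟨ regroup n (4 ^ n) (n !) ⟩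
  (2 + (n + n)) * (2 + (n + n)) * (4 ^ n * (n ! * n !))
    ≤⟨ *-mono-≤ (*-monoˡ-≤ (2 + (n + n)) (n≤1+n (2 + (n + n)))) (4^n*n!²≤[1+2n]! n) ⟩
  (3 + (n + n)) * (2 + (n + n)) * suc (n + n) ! ≡⟨ *-assoc (3 + (n + n)) (2 + (n + n)) (suc (n + n) !) ⟩
  suc (2 + (n + n)) !                          ≡⟨ cong (λ h → suc (suc h) !) (+-suc n n) ⟨
  suc (suc n + suc n) !                        ∎
  where
  open ≤-Reasoning
  regroup : ∀ n q f → 4 * q * (suc n * f * (suc n * f)) ≡ (2 + (n + n)) * (2 + (n + n)) * (q * (f * f))
  regroup = solve-∀

-- M · ∫₀¹ xⁿ(1 - x)ⁿ dx is a positive integer, hence at least 1, while the integral is at most 4⁻ⁿ.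
4^n≤commonMultiple : ∀ {M N} → 1 ≤ M → (∀ j → 1 ≤ j → j ≤ N → j ∣ M) →
  ∀ n → suc (n + n) ≤ N → 4 ^ n ≤ M
4^n≤commonMultiple {M} 1≤M cm n le with beta-multiple cm n n le
... | zero , eq = contradiction (*-mono-≤ 1≤M (*-mono-≤ (1≤n! n) (1≤n! n)))
                                (<⇒≱ (subst (_< 1) eq (s≤s z≤n)))
... | suc u , eq = *-cancelʳ-≤ (4 ^ n) M (n ! * n !) {{n !* n !≢0}} (begin
  4 ^ n * (n ! * n !)      ≤⟨ 4^n*n!²≤[1+2n]! n ⟩
  suc (n + n) !            ≤⟨ m≤m+n _ (u * suc (n + n) !) ⟩
  suc u * suc (n + n) !    ≡⟨ eq ⟩
  M * (n ! * n !)          ∎)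
  where open ≤-Reasoning

split-prime-power : ∀ {p} → Prime p → ∀ j → 1 ≤ j →
  ∃[ a ] ∃[ c ] (j ≡ p ^ a * c × ¬ (p ∣ c))
split-prime-power {p} pp = <-rec _ step
  where
  instance _ = prime⇒nonTrivial pp
  step : ∀ j → (∀ {c} → c < j → 1 ≤ c → ∃[ a ] ∃[ d ] (c ≡ p ^ a * d × ¬ (p ∣ d))) →
         1 ≤ j → ∃[ a ] ∃[ d ] (j ≡ p ^ a * d × ¬ (p ∣ d))
  step j ih 1≤j with p ∣? j
  ... | no p∤j = 0 , j , sym (*-identityˡ j) , p∤j
  ... | yes (divides zero refl) = contradiction 1≤j (λ ())
  ... | yes (divides c@(suc _) refl) with ih (m<m*n c p (nonTrivial⇒n>1 p)) (s≤s z≤n)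
  ...   | a , d , eq , p∤d = suc a , d , trans (cong (_* p) eq) (regroup p (p ^ a) d) , p∤d
    where
    regroup : ∀ p q d → q * d * p ≡ p * q * d
    regroup = solve-∀

no-prime-divisor⇒≡1 : ∀ j → 1 ≤ j → (∀ p → Prime p → ¬ (p ∣ j)) → j ≡ 1
no-prime-divisor⇒≡1 j 1≤j h with factorise j {{>-nonZero 1≤j}}
... | record { factors = [] ; isFactorisation = eq } = eq
... | record { factors = p ∷ ps ; isFactorisation = refl ; factorsPrime = pp ∷ _ } =
  contradiction (m∣m*n _) (h p pp)

-- Induction on the smoothness bound `m`: a prime `suc m` contributes its largest power not
-- exceeding `N`, at the cost of one factor `N`; a non-prime contributes nothing.
smooth-commonMultiple : ∀ N → 1 ≤ N → ∀ m → ∃[ M ] (1 ≤ M × M ≤ N ^ primeCount m ×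
  (∀ j → 1 ≤ j → j ≤ N → (∀ p → Prime p → p ∣ j → p ≤ m) → j ∣ M))
smooth-commonMultiple N 1≤N zero = 1 , ≤-refl , ≤-refl , λ j 1≤j _ smooth →
  ∣-reflexive (no-prime-divisor⇒≡1 j 1≤j λ p pp p∣j →
    contradiction (smooth p pp p∣j) (<⇒≱ (>-nonZero⁻¹ p {{prime⇒nonZero pp}})))
smooth-commonMultiple N 1≤N (suc m) with smooth-commonMultiple N 1≤N m
... | M , 1≤M , M≤ , cm with prime? (suc m)
...   | no ¬p = M , 1≤M , M≤ ,
        λ j 1≤j j≤N smooth → cm j 1≤j j≤N λ r pr r∣j →
          ≤-pred (≤∧≢⇒< (smooth r pr r∣j) λ { refl → ¬p pr })
...   | yes pp with ^-bracket (suc m) (nonTrivial⇒n>1 (suc m) {{prime⇒nonTrivial pp}}) N 1≤N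
...     | e , lo , hi = p ^ e * M , *-mono-≤ (m^n>0 p e) 1≤M , *-mono-≤ lo M≤ , cm′
  where
  p = suc m
  cm′ : ∀ j → 1 ≤ j → j ≤ N → (∀ r → Prime r → r ∣ j → r ≤ p) → j ∣ p ^ e * M
  cm′ j 1≤j j≤N smooth with split-prime-power pp j 1≤j
  ... | a , zero , _ , p∤0 = contradiction (p ∣0) p∤0
  -- `p ^ a ≤ j ≤ N < p ^ suc e` gives `a ≤ e`, and the cofactor `c`, free of `p`, falls under the
  -- induction hypothesis.
  ... | a , c@(suc _) , refl , p∤c = *-pres-∣
    (^-monoʳ-∣ p {a} {e} (≤-pred (^-cancel-< p {a} {suc e} (≤-<-trans (≤-trans (m≤m*n (p ^ a) c) j≤N) hi))))
    (cm c (s≤s z≤n) (≤-trans (m≤n*m c (p ^ a) {{m^n≢0 p a}}) j≤N) λ r pr r∣c →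
      ≤-pred (≤∧≢⇒< (smooth r pr (∣n⇒∣m*n (p ^ a) r∣c)) λ { refl → p∤c r∣c }))

4^n≤x^primeCount : ∀ x n → suc (n + n) ≤ x → 4 ^ n ≤ x ^ primeCount x
4^n≤x^primeCount x n le with smooth-commonMultiple x (≤-trans (s≤s z≤n) le) x
... | M , 1≤M , M≤ , cm = ≤-trans (4^n≤commonMultiple 1≤M cm′ n le) M≤
  where
  cm′ : ∀ j → 1 ≤ j → j ≤ x → j ∣ M
  cm′ j 1≤j j≤x = cm j 1≤j j≤x λ p _ p∣j → ≤-trans (∣⇒≤ {{>-nonZero 1≤j}} p∣j) j≤x

-- Take n = 2ᵗ - 1, so that 2n + 1 ≤ x. Comparing exponents of 2 in 4ⁿ ≤ x^π(x) ≤ 2^((2 + t)π(x))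
-- bounds 2n, and 2²⁺ᵗ = 4n + 4.
2^s≤2sπ+4 : ∀ x t → 2 ^ suc t ≤ x → x < 2 ^ (2 + t) →
  2 ^ (2 + t) ≤ 2 * ((2 + t) * primeCount x) + 4
2^s≤2sπ+4 x t lo hi with 2 ^ t in eq
... | zero = z≤n
... | suc n = begin
  2 * (2 * suc n)                        ≡⟨ regroup n ⟩
  2 * (2 * n) + 4                        ≤⟨ +-monoˡ-≤ 4 (*-monoʳ-≤ 2 2n≤) ⟩
  2 * ((2 + t) * primeCount x) + 4       ∎
  where
  open ≤-Reasoning
  regroup : ∀ n → 2 * (2 * suc n) ≡ 2 * (2 * n) + 4
  regroup = solve-∀
  2*suc : ∀ n → suc (suc (n + n)) ≡ 2 * suc n
  2*suc = solve-∀
  x≤2^[2+t] : x ≤ 2 ^ (2 + t)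
  x≤2^[2+t] = <⇒≤ (subst (λ h → x < 2 * (2 * h)) (sym eq) hi)
  2n≤ : 2 * n ≤ (2 + t) * primeCount x
  2n≤ = ^-cancel-≤ 2 (s≤s (s≤s z≤n)) (begin
    2 ^ (2 * n)                      ≡⟨ ^-*-assoc 2 2 n ⟨
    4 ^ n                            ≤⟨ 4^n≤x^primeCount x n
                                          (≤-trans (n≤1+n _) (≤-trans (≤-reflexive (2*suc n)) lo)) ⟩
    x ^ primeCount x                 ≤⟨ ^-monoˡ-≤ (primeCount x) x≤2^[2+t] ⟩
    (2 ^ (2 + t)) ^ primeCount x     ≡⟨ ^-*-assoc 2 (2 + t) (primeCount x) ⟩
    2 ^ ((2 + t) * primeCount x)     ∎)

-- π(x) outgrows every multiple of the binary length `s` of `x`. Otherwise s³ ≤ 2ˢ ≤ 2Es² + 4 ≤ (2E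
-- + 4)s², which bounds `s` by 2E + 4.
linear-log≤primeCount : ∀ E → ∃[ X ] (∀ x → X ≤ x → ∃[ s ] (x < 2 ^ s × 1 ≤ s × E * s ≤ primeCount x))
linear-log≤primeCount E = 2 ^ T , bound
  where
  open ≤-Reasoning
  -- The 10 makes `cube≤2^` applicable; the rest forces `s` above 2E + 4.
  T = 10 + (2 * E + 4)
  bound : ∀ x → 2 ^ T ≤ x → ∃[ s ] (x < 2 ^ s × 1 ≤ s × E * s ≤ primeCount x)
  bound x X≤x with ^-bracket 2 (s≤s (s≤s z≤n)) x (≤-trans (m^n>0 2 T) X≤x)
  ... | t , lo , hi with ^-cancel-< 2 {T} {suc t} (≤-<-trans X≤x hi)
  bound x X≤x | zero , lo , hi | s≤s ()
  bound x X≤x | suc t , lo , hi | T<s = s , hi , s≤s z≤n , ≮⇒≥ impossible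
    where
    s = 2 + t
    10≤s : 10 ≤ s
    10≤s = ≤-trans (m≤m+n 10 (2 * E + 4)) (<⇒≤ T<s)
    cube≤ : s * (s * s) ≤ 2 ^ s
    cube≤ = subst (λ h → h * (h * h) ≤ 2 ^ h) (m+[n∸m]≡n 10≤s) (cube≤2^ (s ∸ 10))
    factor : ∀ s E → 2 * (s * (E * s)) + 4 * (s * s) ≡ (2 * E + 4) * (s * s)
    factor = solve-∀
    impossible : ¬ (primeCount x < E * s)
    impossible π<Es = <⇒≱ (≤-<-trans (m≤n+m (2 * E + 4) 10) T<s)
      (*-cancelʳ-≤ s (2 * E + 4) (s * s) (begin
        s * (s * s)                    ≤⟨ cube≤ ⟩
        2 ^ s                          ≤⟨ 2^s≤2sπ+4 x t lo hi ⟩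
        2 * (s * primeCount x) + 4     ≤⟨ +-mono-≤ (*-monoʳ-≤ 2 (*-monoʳ-≤ s (<⇒≤ π<Es)))
                                            (*-monoʳ-≤ 4 {1} {s * s} (s≤s z≤n)) ⟩
        2 * (s * (E * s)) + 4 * (s * s) ≡⟨ factor s E ⟩
        (2 * E + 4) * (s * s)          ∎))

-- Growth of the sequence

length-range1 : ∀ n → length (range1 n) ≡ n
length-range1 zero = refl
length-range1 (suc n) = cong suc (length-range1 n)

-- The bound is uniform in `n`, so it controls the count over all indices.
countUpTo-bound : ∀ a x B → (∀ i → B ≤ i → x < a i) → ∀ n → countUpTo a n x ≤ B
countUpTo-bound a x B big zero = z≤n
countUpTo-bound a x B big (suc n) with B ≤? suc n
... | yes B≤ = subst (λ l → length l ≤ B)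
  (sym (filter-reject (λ i → a i ≤? x) (<⇒≱ (big (suc n) B≤)))) (countUpTo-bound a x B big n)
... | no B≰ = ≤-trans (length-filter (λ i → a i ≤? x) (range1 (suc n)))
  (≤-trans (≤-reflexive (length-range1 (suc n))) (<⇒≤ (≰⇒> B≰)))

oddPrime-∣-double⇒≡ : ∀ {x y} → OddPrime x → OddPrime y → x ∣ y + y → x ≡ y
oddPrime-∣-double⇒≡ {x} {y} (px , 2∤x) (py , _) x∣ with
  euclidsLemma 2 y px (subst (x ∣_) (cong (y +_) (sym (+-identityʳ y))) x∣)
... | inj₁ x∣2 with prime⇒irreducible prime[2] x∣2
...   | inj₁ refl = contradiction px ¬prime[1]
...   | inj₂ refl = contradiction ∣-refl 2∤x
oddPrime-∣-double⇒≡ (px , _) (py , _) _ | inj₂ x∣y with prime⇒irreducible py x∣y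
... | inj₁ refl = contradiction px ¬prime[1]
... | inj₂ x≡y = x≡y

∣-sum⇒3x≤2z : ∀ {x y z} → x ∣ y + z → x < y → y < z → 3 * x ≤ 2 * z
∣-sum⇒3x≤2z {x} {y} {z} (divides q eq) x<y y<z with 3 ≤? q
... | yes 3≤q = begin
  3 * x  ≤⟨ *-monoˡ-≤ x 3≤q ⟩
  q * x  ≡⟨ eq ⟨
  y + z  ≤⟨ +-monoˡ-≤ z (<⇒≤ y<z) ⟩
  z + z  ≡⟨ cong (z +_) (+-identityʳ z) ⟨
  2 * z  ∎
  where open ≤-Reasoning
... | no 3≰q = contradiction (begin-strict
  2 * x  ≡⟨ cong (x +_) (+-identityʳ x) ⟩
  x + x  <⟨ +-mono-< x<y (<-trans x<y y<z) ⟩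
  y + z  ≡⟨ eq ⟩
  q * x  ≤⟨ *-monoˡ-≤ x (≤-pred (≰⇒> 3≰q)) ⟩
  2 * x  ∎) (<-irrefl refl)
  where open ≤-Reasoning

-- Two factors 3/2 give 9/4, which exceeds 2.
3x≤2z∧3z≤2w⇒2x≤w : ∀ x z w → 3 * x ≤ 2 * z → 3 * z ≤ 2 * w → 2 * x ≤ w
3x≤2z∧3z≤2w⇒2x≤w x z w p q = *-cancelˡ-≤ 4 (begin
  4 * (2 * x)        ≤⟨ m≤n+m _ x ⟩
  x + 4 * (2 * x)    ≡⟨ r₁ x ⟩
  3 * (3 * x)        ≤⟨ *-monoʳ-≤ 3 p ⟩
  3 * (2 * z)        ≡⟨ r₂ z ⟩
  2 * (3 * z)        ≤⟨ *-monoʳ-≤ 2 q ⟩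
  2 * (2 * w)        ≡⟨ *-assoc 2 2 w ⟨
  4 * w              ∎)
  where
  open ≤-Reasoning
  r₁ : ∀ x → x + 4 * (2 * x) ≡ 3 * (3 * x)
  r₁ = solve-∀
  r₂ : ∀ z → 3 * (2 * z) ≡ 2 * (3 * z)
  r₂ = solve-∀

¬strictly-decreasing : ∀ (b : ℕ → ℕ) → ¬ (∀ i → b (suc i) < b i)
¬strictly-decreasing b dec = <⇒≱ (n<1+n (b 0))
  -- After `suc (b 0)` steps the total drop would exceed the initial value.
  (≤-trans (m≤n+m (suc (b 0)) (b (suc (b 0)))) (sum≤ (suc (b 0))))
  where
  open ≤-Reasoning
  sum≤ : ∀ s → b s + s ≤ b 0
  sum≤ zero = ≤-reflexive (+-identityʳ (b 0))
  sum≤ (suc s) = begin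
    b (suc s) + suc s  ≡⟨ +-suc (b (suc s)) s ⟩
    suc (b (suc s)) + s ≤⟨ +-monoˡ-≤ s (dec s) ⟩
    b s + s            ≤⟨ sum≤ s ⟩
    b 0                ∎

mono-from : ∀ {a : ℕ → ℕ} {N} → (∀ i → N ≤ i → a i ≤ a (suc i)) →
  ∀ {i} d → N ≤ i → a i ≤ a (d + i)
mono-from up zero N≤i = ≤-refl
mono-from up {i} (suc d) N≤i =
  ≤-trans (mono-from up d N≤i) (up (d + i) (≤-trans N≤i (m≤n+m i d)))

module _ {a : ℕ → ℕ} (rpf : IsRPF a) where

  next : ∀ i → IsNextTerm (a (suc i)) (a (2 + i)) (a (3 + i))
  next i = let (_ , _ , _ , _ , _ , _ , _ , h) = rpf in h (suc i) (s≤s z≤n)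

  terms-oddPrime : ∀ i → OddPrime (a (suc i))
  terms-oddPrime i = proj₁ (proj₁ (proj₂ (next i)))

  term-∣-sum : ∀ i → a (suc i) ∣ a (2 + i) + a (3 + i)
  term-∣-sum i = proj₁ (proj₂ (proj₁ (proj₂ (next i))))

  -- An equality propagates backwards: if two consecutive terms equal y, the term x before them
  -- divides 2y, so x = y. This descends to p = q.
  consecutive-≢ : ∀ i → a (suc i) ≢ a (2 + i)
  consecutive-≢ zero = let (_ , _ , _ , _ , p≢q , a1 , a2 , _) = rpf in
    λ eq → p≢q (trans (sym a1) (trans eq a2))
  consecutive-≢ (suc i) eq = consecutive-≢ i
    (oddPrime-∣-double⇒≡ (terms-oddPrime i) (terms-oddPrime (suc i))
      (subst (λ h → a (suc i) ∣ a (2 + i) + h) (sym eq) (term-∣-sum i)))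

  module _ {N} (up : ∀ i → N ≤ i → a i ≤ a (suc i)) where

    strict : ∀ i → N ≤ i → a (suc i) < a (2 + i)
    strict i N≤i = ≤∧≢⇒< (up (suc i) (m≤n⇒m≤1+n N≤i)) (consecutive-≢ i)

    3/2-growth : ∀ i → N ≤ i → 3 * a (suc i) ≤ 2 * a (3 + i)
    3/2-growth i N≤i = ∣-sum⇒3x≤2z (term-∣-sum i) (strict i N≤i) (strict (suc i) (m≤n⇒m≤1+n N≤i))

    doubling : ∀ i → N ≤ i → 2 * a (suc i) ≤ a (5 + i)
    doubling i N≤i = 3x≤2z∧3z≤2w⇒2x≤w (a (suc i)) (a (3 + i)) (a (5 + i))
      (3/2-growth i N≤i) (3/2-growth (2 + i) (≤-trans N≤i (m≤n+m i 2)))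

    2^s≤term : ∀ s → 2 ^ s ≤ a (s * 4 + suc N)
    2^s≤term zero = >-nonZero⁻¹ _ {{prime⇒nonZero (proj₁ (terms-oddPrime N))}}
    2^s≤term (suc s) = begin
      2 * 2 ^ s                    ≤⟨ *-monoʳ-≤ 2 (2^s≤term s) ⟩
      2 * a (s * 4 + suc N)        ≡⟨ cong (λ h → 2 * a h) (+-suc (s * 4) N) ⟩
      2 * a (suc (s * 4 + N))      ≤⟨ doubling (s * 4 + N) (m≤n+m N (s * 4)) ⟩
      a (5 + (s * 4 + N))          ≡⟨ cong (λ h → a (4 + h)) (+-suc (s * 4) N) ⟨
      a (suc s * 4 + suc N)        ∎
      where open ≤-Reasoning

    -- The term at index `s * 4 + suc N` already exceeds `x`, and by monotonicity so do all later
    -- ones.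
    countUpTo-log : ∀ {x s} → x < 2 ^ s → ∀ n → countUpTo a n x ≤ s * 4 + suc N
    countUpTo-log {x} {s} x<2^s = countUpTo-bound a x (s * 4 + suc N) λ i B≤i →
      <-≤-trans x<2^s (≤-trans (2^s≤term s)
        (subst (λ h → a (s * 4 + suc N) ≤ a h) (m∸n+n≡m B≤i)
          (mono-from up (i ∸ (s * 4 + suc N)) (≤-trans (n≤1+n N) (m≤n+m (suc N) (s * 4))))))

-- The limit is expressed with ε = 1/k. Since `X` is chosen before `n`, the estimate covers the
-- count over all indices.
theorem3p2 : (a : ℕ → ℕ) → IsRPF a → EventuallyMonotonic a →
    ∀ k → 1 ≤ k → ∃[ X ] (∀ x → X ≤ x → ∀ n → k * countUpTo a n x ≤ primeCount x)
-- A nonincreasing tail would be strictly decreasing, as consecutive terms differ; this is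
-- impossible in ℕ.
theorem3p2 a rpf (N , inj₂ down) k _ = contradiction
  (λ i → ≤∧≢⇒< (down (suc (i + N)) (m≤n⇒m≤1+n (m≤n+m N i))) (consecutive-≢ rpf (i + N) ∘ sym))
  (¬strictly-decreasing (λ i → a (suc (i + N))))
theorem3p2 a rpf (N , inj₁ up) k _ = proj₁ large , λ x X≤x n →
  let (s , x<2^s , 1≤s , Es≤π) = proj₂ large x X≤x
      instance _ = >-nonZero 1≤s
  in begin
    k * countUpTo a n x      ≤⟨ *-monoʳ-≤ k (countUpTo-log rpf up {s = s} x<2^s n) ⟩
    k * (s * 4 + suc N)      ≤⟨ *-monoʳ-≤ k (+-monoʳ-≤ (s * 4) (m≤n*m (suc N) s)) ⟩
    k * (s * 4 + s * suc N)  ≡⟨ factor k s (suc N) ⟩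
    k * (4 + suc N) * s      ≤⟨ Es≤π ⟩
    primeCount x             ∎
  where
  open ≤-Reasoning
  -- As s ≥ 1, the count 4s + N + 1 is at most (4 + N + 1)s, which fixes the constant.
  large = linear-log≤primeCount (k * (4 + suc N))
  factor : ∀ k s n → k * (s * 4 + s * n) ≡ k * (4 + n) * s
  factor = solve-∀
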